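{- If $\perp$ is a canonical independence relation, then $\perp=\perp^{\text{þ}}$, i.e. $\perp$ is thorn-forking independence.
   Context: $T$ is a complete consistent first-order theory (possibly many-sorted, e.g. of the form $T^{\mathrm{eq}}$); we work in a big saturated model of $T$. All sets are small subsets of the big model; $BC$ means $B\cup C$; $\operatorname{acl}$ is algebraic closure. $A\equiv_BA'$ means that some automorphism fixing $B$ pointwise maps the set $A$ onto $A'$; $(A,B,C)\equiv(A',B',C')$ means that some automorphism maps $A,B,C$ onto $A',B',C'$ respectively. An independence relation is a ternary relation $\perp$ between small sets satisfying: - (invariance) If $A\perp_CB$ and $(A',B',C')\equiv(A,B,C)$, then $A'\perp_{C'}B'$. - (monotonicity) If $A\perp_CB$, $A'\subseteq A$, $B'\subseteq B$, then $A'\perp_CB'$. - (base monotonicity) If $D\subseteq C\subseteq B$ and $A\perp_DB$, then $A\perp_CB$. - (transitivity) If $D\subseteq C\subseteq B$, $B\perp_CA$ and $C\perp_DA$, then $B\perp_DA$. - (normality) $A\perp_CB$ implies $AC\perp_CB$. - (extension) If $A\perp_CB$ and $\hat B\supseteq B$, then there is $A'\equiv_{BC}A$ with $A'\perp_C\hat B$. - (finite character) If $A_0\perp_CB$ for all finite $A_0\subseteq A$, then $A\perp_CB$. - (local character) For every $A$ there is a cardinal $\kappa(A)$ such that for any $B$ there is $C\subseteq B$ with $|C|<\kappa(A)$ and $A\perp_CB$. It is strict if moreover (anti-reflexivity) $a\perp_Ba$ implies $a\in\operatorname{acl}B$. It is canonical if it is strict and has the intersection property: whenever $C_1\subseteq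 B$ and $C_2\subseteq B$ are such that $A\perp_{C_1}B$ and $A\perp_{C_2}B$, then $A\perp_{\operatorname{acl}C_1\cap\operatorname{acl}C_2}B$. M-dividing independence: $A\perp^M_CB$ iff $\operatorname{acl}(AC')\cap\operatorname{acl}(BC')=\operatorname{acl}C'$ for every $C'$ with $C\subseteq C'\subseteq\operatorname{acl}(BC)$. Thorn-forking independence: $A\perp^{\text{þ}}_CB$ iff for all $\hat B\supseteq B$ there is $A'\equiv_{BC}A$ such that $A'\perp^M_C\hat B$. -}

module Defs where

open import Level using (Level; 0ℓ; _⊔_) renaming (suc to lsuc)
open import Data.Empty.Polymorphic using (⊥)
open import Data.List.Base using (List; []; _∷_; map)
open import Data.List.Membership.Propositional using () renaming (_∈_ to _∈ₗ_)
open import Data.List.Relation.Unary.All as All using (All; []; _∷_)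
import Data.List.Relation.Unary.All.Properties as All
open import Data.Product.Base using (Σ; Σ-syntax; ∃; ∃-syntax; _×_; _,_; proj₁; proj₂)
open import Data.Sum.Base using (_⊎_)
open import Function.Bundles using (_⇔_; _↔_; Inverse; Injection; Surjection)
open import Relation.Binary.Bundles using (Setoid)
import Relation.Binary.Construct.On as On
open import Relation.Binary.PropositionalEquality using (_≡_; setoid)
open import Relation.Nullary using (¬_)
open import Relation.Unary using (Pred; _∈_; _⊆_; _≐_; _∪_; _∩_; ｛_｝)

record Signature : Set₁ where
  field
    Sort : Set
    Fun  : List Sort → Sort → Set
    Rel  : List Sort → Set

module Syntax (L : Signature) where
  open Signature L

  -- A context lists the sorts of the free variables (de Bruijn style).

  data Term (Γ : List Sort) : Sort → Set where
    var : ∀ {s} → s ∈ₗ Γ → Term Γ s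
    app : ∀ {Δ s} → Fun Δ s → All (Term Γ) Δ → Term Γ s

  -- The remaining connectives are classically definable from these.

  data Formula (Γ : List Sort) : Set where
    false : Formula Γ
    _≈_   : ∀ {s} → Term Γ s → Term Γ s → Formula Γ
    atom  : ∀ {Δ} → Rel Δ → All (Term Γ) Δ → Formula Γ
    _⇒_   : Formula Γ → Formula Γ → Formula Γ
    all   : ∀ s → Formula (s ∷ Γ) → Formula Γ

  neg : ∀ {Γ} → Formula Γ → Formula Γ
  neg φ = φ ⇒ false

  Sentence : Set
  Sentence = Formula []

  Theory : Set₁
  Theory = Pred Sentence 0ℓ

record Structure (L : Signature) (ℓ : Level) : Set (lsuc ℓ) where
  open Signature L
  field
    Carrier  : Sort → Set ℓ
    nonempty : ∀ s → Carrier s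
    fun      : ∀ {Δ s} → Fun Δ s → All Carrier Δ → Carrier s
    rel      : ∀ {Δ} → Rel Δ → All Carrier Δ → Set ℓ

module Semantics {L : Signature} {ℓ : Level} (M : Structure L ℓ) where
  open Signature L
  open Syntax L
  private module M = Structure M

  mutual
    eval : ∀ {Γ s} → Term Γ s → All M.Carrier Γ → M.Carrier s
    eval (var i)    ρ = All.lookup ρ i
    eval (app f ts) ρ = M.fun f (evals ts ρ)

    evals : ∀ {Γ Δ} → All (Term Γ) Δ → All M.Carrier Γ → All M.Carrier Δ
    evals []       ρ = []
    evals (t ∷ ts) ρ = eval t ρ ∷ evals ts ρ

  ⟦_⟧ : ∀ {Γ} → Formula Γ → All M.Carrier Γ → Set ℓ
  ⟦ false ⟧     ρ = ⊥
  ⟦ t ≈ u ⟧     ρ = eval t ρ ≡ eval u ρ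
  ⟦ atom R ts ⟧ ρ = M.rel R (evals ts ρ)
  ⟦ φ ⇒ ψ ⟧     ρ = ⟦ φ ⟧ ρ → ⟦ ψ ⟧ ρ
  ⟦ all s φ ⟧   ρ = ∀ (a : M.Carrier s) → ⟦ φ ⟧ (a ∷ ρ)

  IsModelOf : Theory → Set ℓ
  IsModelOf T = ∀ φ → φ ∈ T → ⟦ φ ⟧ []

module _ {L : Signature} where
  open Syntax L
  open Semantics

  -- The language is a small set, so by the downward Löwenheim–Skolem
  -- theorem it suffices to consider models in the lowest universe.

  Consistent : Theory → Set₁
  Consistent T = Σ[ M ∈ Structure L 0ℓ ] IsModelOf M T

  _⊩_ : Theory → Sentence → Set₁
  T ⊩ φ = ∀ (M : Structure L 0ℓ) → IsModelOf M T → ⟦_⟧ M φ []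

  Complete : Theory → Set₁
  Complete T = ∀ φ → (T ⊩ φ) ⊎ (T ⊩ neg φ)

-- The big model lives in Set₁, and "small" means "indexed by a type in
-- Set"; in particular cardinals (of small sets) are represented by types
-- in Set.

module BigModel {L : Signature} (𝔐 : Structure L (lsuc 0ℓ)) where
  open Signature L
  open Syntax L
  open Structure 𝔐
  open Semantics 𝔐

  Element : Set₁
  Element = Σ Sort Carrier

  Subset : Set₂
  Subset = Pred Element (lsuc 0ℓ)

  -- The elements of A, identified when they are equal in the model
  -- (membership proofs are ignored).

  ⟪_⟫ : Subset → Setoid (lsuc 0ℓ) (lsuc 0ℓ)
  ⟪ A ⟫ = On.setoid {B = ∃ A} (setoid Element) proj₁

  Small : Subset → Set₁
  Small A = Σ[ I ∈ Set ] Surjection (setoid I) ⟪ A ⟫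

  Finite : Subset → Set₁
  Finite A = Σ[ xs ∈ List Element ] (∀ {x} → x ∈ A → x ∈ₗ xs)

  ∣_∣<_ : Subset → Set → Set₁
  ∣ A ∣< K = Injection ⟪ A ⟫ (setoid K) × ¬ Injection (setoid K) ⟪ A ⟫

  -- φ(x , b), where x has sort s and b is a tuple of parameters.

  Formulaᴹ : Sort → Set₁
  Formulaᴹ s = Σ[ Γ ∈ List Sort ] Formula (s ∷ Γ) × All Carrier Γ

  Sat : ∀ {s} → Carrier s → Formulaᴹ s → Set₁
  Sat a (_ , φ , b) = ⟦ φ ⟧ (a ∷ b)

  _Over_ : ∀ {s} → Formulaᴹ s → Subset → Set₁
  (Γ , _ , b) Over A = ∀ {t} (i : t ∈ₗ Γ) → (t , All.lookup b i) ∈ A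

  acl : Subset → Subset
  acl A (s , a) =
    Σ[ φ ∈ Formulaᴹ s ] φ Over A × Sat a φ ×
      (Σ[ xs ∈ List (Carrier s) ] (∀ x → Sat x φ → x ∈ₗ xs))

  record Automorphism : Set₁ where
    field
      bij : ∀ s → Carrier s ↔ Carrier s

    to : ∀ {s} → Carrier s → Carrier s
    to {s} = Inverse.to (bij s)

    field
      fun-pres : ∀ {Δ s} (f : Fun Δ s) (xs : All Carrier Δ) →
                 to (fun f xs) ≡ fun f (All.map to xs)
      rel-pres : ∀ {Δ} (R : Rel Δ) (xs : All Carrier Δ) →
                 rel R xs ⇔ rel R (All.map to xs)

    act : Element → Element
    act (s , a) = s , to a

  open Automorphism using (to; act)

  _MapsOnto_,_ : Automorphism → Subset → Subset → Set₁
  σ MapsOnto A , A′ = (λ y → ∃[ x ] x ∈ A × act σ x ≡ y) ≐ A′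

  _≡[_]_ : Subset → Subset → Subset → Set₁
  A ≡[ B ] A′ = Σ[ σ ∈ Automorphism ]
    (∀ x → x ∈ B → act σ x ≡ x) × σ MapsOnto A , A′

  -- Stated for partial 1-types, which is equivalent to complete ones.

  Saturated : Set₂
  Saturated = ∀ (A : Subset) → Small A →
    ∀ s (p : Pred (Formulaᴹ s) (lsuc 0ℓ)) → (∀ {φ} → φ ∈ p → φ Over A) →
    (∀ φs → All p φs → ∃[ a ] All (Sat a) φs) →
    ∃[ a ] (∀ φ → φ ∈ p → Sat a φ)

  -- A model saturated in its own cardinality has this property; as usual
  -- for monster models it is assumed instead of that cardinality.

  StronglyHomogeneous : Set₁
  StronglyHomogeneous = ∀ (I : Set) (sort : I → Sort)
    (a b : ∀ i → Carrier (sort i)) →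
    (∀ (is : List I) (φ : Formula (map sort is)) →
       ⟦ φ ⟧ (All.map⁺ (All.universal a is)) ⇔
       ⟦ φ ⟧ (All.map⁺ (All.universal b is))) →
    Σ[ σ ∈ Automorphism ] (∀ i → to σ (a i) ≡ b i)

  -- Ternary relations are defined on all subsets, but only their values
  -- at small subsets are ever used.  The arguments of R A C B are in the
  -- order of A ⊥[ C ] B.

  TernaryRelation : ∀ ℓ → Set (lsuc (lsuc 0ℓ) ⊔ lsuc ℓ)
  TernaryRelation ℓ = Subset → Subset → Subset → Set ℓ

  record IsIndependenceRelation {ℓ} (_⊥[_]_ : TernaryRelation ℓ)
         : Set (lsuc (lsuc 0ℓ) ⊔ ℓ) where
    field
      invariance : ∀ {A B C A′ B′ C′} →
        Small A → Small B → Small C → Small A′ → Small B′ → Small C′ →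
        A ⊥[ C ] B →
        (Σ[ σ ∈ Automorphism ]
          σ MapsOnto A′ , A × σ MapsOnto B′ , B × σ MapsOnto C′ , C) →
        A′ ⊥[ C′ ] B′
      monotonicity : ∀ {A B C A′ B′} →
        Small A → Small B → Small C → Small A′ → Small B′ →
        A ⊥[ C ] B → A′ ⊆ A → B′ ⊆ B → A′ ⊥[ C ] B′
      base-monotonicity : ∀ {A B C D} →
        Small A → Small B → Small C → Small D →
        D ⊆ C → C ⊆ B → A ⊥[ D ] B → A ⊥[ C ] B
      transitivity : ∀ {A B C D} →
        Small A → Small B → Small C → Small D →
        D ⊆ C → C ⊆ B → B ⊥[ C ] A → C ⊥[ D ] A → B ⊥[ D ] A
      normality : ∀ {A B C} →
        Small A → Small B → Small C →
        A ⊥[ C ] B → (A ∪ C) ⊥[ C ] B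
      extension : ∀ {A B C B̂} →
        Small A → Small B → Small C → Small B̂ →
        A ⊥[ C ] B → B ⊆ B̂ →
        ∃[ A′ ] A′ ≡[ B ∪ C ] A × A′ ⊥[ C ] B̂
      finite-character : ∀ {A B C} →
        Small A → Small B → Small C →
        (∀ A₀ → Finite A₀ → A₀ ⊆ A → A₀ ⊥[ C ] B) → A ⊥[ C ] B
      local-character : ∀ {A} → Small A →
        Σ[ κ ∈ Set ] (∀ {B} → Small B →
          ∃[ C ] C ⊆ B × ∣ C ∣< κ × A ⊥[ C ] B)

  record IsStrict {ℓ} (_⊥[_]_ : TernaryRelation ℓ)
         : Set (lsuc (lsuc 0ℓ) ⊔ ℓ) where
    field
      isIndependenceRelation : IsIndependenceRelation _⊥[_]_
      anti-reflexivity : ∀ {a B} → Small B →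
        ｛ a ｝ ⊥[ B ] ｛ a ｝ → a ∈ acl B

  record IsCanonical {ℓ} (_⊥[_]_ : TernaryRelation ℓ)
         : Set (lsuc (lsuc 0ℓ) ⊔ ℓ) where
    field
      isStrict : IsStrict _⊥[_]_
      intersection : ∀ {A B C₁ C₂} →
        Small A → Small B → Small C₁ → Small C₂ →
        C₁ ⊆ B → C₂ ⊆ B → A ⊥[ C₁ ] B → A ⊥[ C₂ ] B →
        A ⊥[ acl C₁ ∩ acl C₂ ] B

  _⊥ᴹ[_]_ : TernaryRelation (lsuc (lsuc 0ℓ))
  A ⊥ᴹ[ C ] B = ∀ C′ → C ⊆ C′ → C′ ⊆ acl (B ∪ C) →
    (acl (A ∪ C′) ∩ acl (B ∪ C′)) ≐ acl C′

  _⊥þ[_]_ : TernaryRelation (lsuc (lsuc 0ℓ))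
  A ⊥þ[ C ] B = ∀ B̂ → Small B̂ → B ⊆ B̂ →
    ∃[ A′ ] A′ ≡[ B ∪ C ] A × A′ ⊥ᴹ[ C ] B̂

{-# OPTIONS --safe #-}
-- Extension and local character make ⊥ symmetric, so A ⊥[ C ] B passes to
-- algebraic closures on both sides; anti-reflexivity then gives ⊥ᴹ, and
-- extension gives ⊥þ.  Conversely, if A ⊥þ[ C ] B, then some conjugate A′ of A
-- satisfies A′ ⊥ᴹ[ C ] B̂ for a B̂ containing a long sequence of conjugates of A′
-- over a base D with A′ ⊥[ D ] B̂.  By ⊥ᴹ, acl D meets the algebraic closure of C and
-- the sequence in acl C only, while A′ is independent over either of them, so
-- the intersection property brings the base down to acl C.

module Submission where

open import Defs
open import Level using (Level; 0ℓ; suc; Lift; lift; lower)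
open import Axiom.ExcludedMiddle using (ExcludedMiddle)
open import Axiom.Extensionality.Propositional using (Extensionality)
open import Data.Bool.Base using (Bool; T)
open import Data.Empty using (⊥; ⊥-elim)
open import Data.Fin.Base using (Fin)
open import Data.List.Base using (List; []; _∷_; map; filter; length; lookup)
open import Data.List.Membership.Propositional using () renaming (_∈_ to _∈ₗ_)
open import Data.List.Membership.Propositional.Properties using (∈-map⁺; ∈-filter⁺)
open import Data.List.Relation.Unary.All as All using (All; []; _∷_)
import Data.List.Relation.Unary.All.Properties as All
open import Data.List.Relation.Unary.Any using (here; there; index)
open import Data.List.Relation.Unary.Any.Properties using (lookup-index)
open import Data.Product.Base using (Σ-syntax; ∃; ∃-syntax; _×_; _,_; proj₁; proj₂)
open import Data.Sum.Base using (_⊎_; inj₁; inj₂; [_,_]′)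
import Data.Sum.Base as Sum
open import Function.Base using (_∘_; id)
open import Function.Bundles using (_⇔_; mk⇔; Inverse; Injection; Surjection; Equivalence)
open import Function.Properties.Inverse using (↔-sym; ↔-refl)
open import Relation.Binary.PropositionalEquality
  using (_≡_; refl; sym; trans; cong; cong₂; subst)
open import Relation.Nullary using (Dec; yes; no)
open import Relation.Nullary.Decidable.Core using (isYes; toWitness; fromWitness; toSum)
open import Relation.Unary using (Pred; _∈_; _⊆_; _≐_; _∪_; _∩_; ｛_｝; ⋃)
open import Relation.Unary.Polymorphic using (∅)
open import Relation.Unary.Properties using (≐-refl; ≐-sym; ≐-trans)

-- Thorn independence demands B̂ before it reveals the conjugate A′, so B̂ cannot be built from A′.
-- Instead its layers store a representative of every type of a conjugate of A, and the sequence
-- belonging to A′ is picked out afterwards. Two different sets stand on the left of local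
-- character: A′, which determines the stage D, and then D itself, whose cardinal is known only once
-- D is. This is why one chain is nested in another. All uses of long chains rest on one pigeonhole:
-- a base of fewer than κ elements fits into a single stage, and base monotonicity enlarges it to
-- that stage. The sequences are not made indiscernible; it is enough that each term is a conjugate
-- over the earlier ones.

private variable
  a b : Level

-- A node may omit some branches, so every partial K-indexed family has a
-- strict upper bound; this makes the whole of Ord K of cofinality above K.
data Ord (K : Set) : Set where
  sup : (Q : K → Bool) → (∃ (T ∘ Q) → Ord K) → Ord K

module _ {K : Set} where

  infix 4 _≤_ _<_

  _≤_ _<_ : Ord K → Ord K → Set
  sup Q f ≤ j       = ∀ k → f k < j
  i       < sup Q g = ∃[ k ] i ≤ g k

  ≤-<-trans : ∀ {i j k} → i ≤ j → j < k → i < k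
  ≤-trans   : ∀ {i j k} → i ≤ j → j ≤ k → i ≤ k
  <-≤-trans : ∀ {i j k} → i < j → j ≤ k → i < k

  ≤-<-trans {k = sup _ _} i≤j (m , j≤k) = m , ≤-trans i≤j j≤k
  ≤-trans {i = sup _ _} i≤j j≤k m = <-≤-trans (i≤j m) j≤k
  <-≤-trans {j = sup _ _} (m , i≤j) j≤k = ≤-<-trans i≤j (j≤k m)

  ≤-refl : ∀ i → i ≤ i
  ≤-refl (sup Q f) k = k , ≤-refl (f k)

  <⇒≤ : ∀ {i j} → i < j → i ≤ j
  <⇒≤ {sup _ _} {sup _ _} (n , i≤j) m = n , <⇒≤ (i≤j m)

  -- A step down along `<` reaches not a subtree but something `≤` a subtree, so the structural
  -- recursion on `i` must treat all `j ≤ i` at once.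
  <-rec : ∀ {p} (P : Ord K → Set p) →
          (∀ i → (∀ j → j < i → P j) → P i) → ∀ i → P i
  <-rec P step i = below i i (≤-refl i)
    where
    below : ∀ i j → j ≤ i → P j
    below (sup _ f) j j≤i = step j λ l l<j →
      let m , l≤fm = <-≤-trans l<j j≤i in below (f m) l l≤fm

-- Truth values, and transfinite chains of sets

module Classical (em : ∀ {a} → ExcludedMiddle a)
                 (ext : ∀ {a b} → Extensionality a b) where

  ⌊_⌋ : Set a → Bool
  ⌊ P ⌋ = isYes (em {P = P})

  ⌊⌋⁺ : {P : Set a} → P → T ⌊ P ⌋
  ⌊⌋⁺ = fromWitness

  ⌊⌋⁻ : {P : Set a} → T ⌊ P ⌋ → P
  ⌊⌋⁻ = toWitness

  ⌊⌋-cong : {P : Set a} {Q : Set b} → (P → Q) → (Q → P) → ⌊ P ⌋ ≡ ⌊ Q ⌋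
  ⌊⌋-cong {P = P} {Q} f g with em {P = P} | em {P = Q}
  ... | yes _ | yes _ = refl
  ... | no _  | no _  = refl
  ... | yes p | no ¬q = ⊥-elim (¬q (f p))
  ... | no ¬p | yes q = ⊥-elim (¬p (g q))

  -- Predicates with the same elements need not be propositionally equal, but
  -- their characteristic functions are.  Choices made from the latter
  -- therefore depend only on the extension of a predicate.
  module _ {X : Set a} where

    char : Pred X b → X → Bool
    char S x = ⌊ S x ⌋

    decode : (X → Bool) → Pred X b
    decode c x = Lift _ (T (c x))

    decode-char : {S : Pred X b} → decode {b = b} (char S) ≐ S
    decode-char = ⌊⌋⁻ ∘ lower , lift ∘ ⌊⌋⁺

    char-cong : {S S′ : Pred X b} → S ≐ S′ → char S ≡ char S′
    char-cong (S⊆S′ , S′⊆S) = ext λ x → ⌊⌋-cong (S⊆S′ {x}) (S′⊆S {x})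

  module _ {K : Set} where

    ≤-⊎-> : (i j : Ord K) → (i ≤ j) ⊎ (j < i)
    <-⊎-≥ : (i j : Ord K) → (i < j) ⊎ (j ≤ i)

    ≤-⊎-> (sup Q f) j with em {P = ∃[ k ] j ≤ f k}
    ... | yes p = inj₂ p
    ... | no ¬p = inj₁ λ k → [ id , (λ q → ⊥-elim (¬p (k , q))) ]′ (<-⊎-≥ (f k) j)
    <-⊎-≥ i (sup Q g) with em {P = ∃[ k ] i ≤ g k}
    ... | yes p = inj₁ p
    ... | no ¬p = inj₂ λ k → [ (λ q → ⊥-elim (¬p (k , q))) , id ]′ (≤-⊎-> i (g k))

  -- The chain X₀ ∪ ⋃ (j < i) A j.  Indices that are equivalent under ≤ need
  -- not be equal, hence the compatibility assumption on A.
  module Chain {X : Set a} {K : Set} (X₀ : Pred X b) (A : Ord K → Pred X b)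
               (A-cong : ∀ {i j} → i ≤ j → j ≤ i → A i ⊆ A j) where

    U : Ord K → Pred X b
    U i = X₀ ∪ λ x → ∃[ j ] j < i × A j x

    U∞ : Pred X b
    U∞ = X₀ ∪ ⋃ (Ord K) A

    U-mono : ∀ {i j} → i ≤ j → U i ⊆ U j
    U-mono i≤j = Sum.map₂ λ (l , l<i , p) → l , <-≤-trans l<i i≤j , p

    X₀⊆U : ∀ i → X₀ ⊆ U i
    X₀⊆U _ = inj₁

    A⊆U : ∀ {i j} → i < j → A i ⊆ U j
    A⊆U i<j p = inj₂ (_ , i<j , p)

    A⊆U∞ : ∀ i → A i ⊆ U∞
    A⊆U∞ i p = inj₂ (i , p)

    U⊆U∞ : ∀ i → U i ⊆ U∞
    U⊆U∞ _ = Sum.map₂ λ (j , _ , p) → j , p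

    -- The largest index that occurs decides. This replaces the split into successor and limit
    -- stages: an induction along the chain only has to treat `U j ∪ A j`.
    finite : ∀ {i} xs → All (U i) xs →
             All X₀ xs ⊎ (∃[ j ] j < i × All (U j ∪ A j) xs)
    finite [] [] = inj₁ []
    finite (x ∷ xs) (p ∷ ps) with p | finite xs ps
    ... | inj₁ q | inj₁ qs = inj₁ (q ∷ qs)
    ... | inj₁ q | inj₂ (j , j<i , qs) = inj₂ (j , j<i , inj₁ (inj₁ q) ∷ qs)
    ... | inj₂ (j , j<i , q) | inj₁ qs =
      inj₂ (j , j<i , inj₂ q ∷ All.map (inj₁ ∘ inj₁) qs)
    ... | inj₂ (j , j<i , q) | inj₂ (l , l<i , qs) with ≤-⊎-> j l
    ...   | inj₂ l<j = inj₂ (j , j<i , inj₂ q ∷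
              All.map (inj₁ ∘ [ U-mono (<⇒≤ l<j) , A⊆U l<j ]′) qs)
    ...   | inj₁ j≤l = inj₂ (l , l<i , top ∷ qs)
      where
      top : (U l ∪ A l) x
      top with <-⊎-≥ j l
      ... | inj₁ j<l = inj₁ (A⊆U j<l q)
      ... | inj₂ l≤j = inj₂ (A-cong j≤l l≤j q)

    cofinal : (Z : Pred X b) → Z ⊆ U∞ → (g : ∃ Z → K) →
              (∀ {z z′} → g z ≡ g z′ → proj₁ z ≡ proj₁ z′) → ∃[ i ] Z ⊆ U i
    cofinal Z Z⊆U∞ g g-inj = bound , λ {z} z∈Z → inside (z , z∈Z) (Z⊆U∞ z∈Z)
      where
      Witness : K → Set _
      Witness k = Σ[ i ∈ Ord K ] Σ[ z ∈ ∃ Z ] g z ≡ k × A i (proj₁ z)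

      -- `Witness k` may live in a larger universe than `K`; its truth value is what can select
      -- branches of a tree.
      Q : K → Bool
      Q k = ⌊ Witness k ⌋

      f : ∃ (T ∘ Q) → Ord K
      f (k , q) = proj₁ (⌊⌋⁻ {P = Witness k} q)

      bound : Ord K
      bound = sup Q f

      inside : ∀ z → U∞ (proj₁ z) → U bound (proj₁ z)
      inside z (inj₁ p) = inj₁ p
      inside z (inj₂ (i , p)) =
        let q = ⌊⌋⁺ {P = Witness (g z)} (i , z , refl , p)
            _ , _ , eq , p′ = ⌊⌋⁻ {P = Witness (g z)} q
        in inj₂ (f (g z , q) , ((g z , q) , ≤-refl _) , subst (A _) (g-inj eq) p′)

  module Iterate {X : Set a} (K : Set) (X₀ : Pred X b)
                 (G : (X → Bool) → Pred X b) where

    stage : Ord K → Pred X b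
    stage (sup Q f) =
      X₀ ∪ λ x → ∃[ k ] (stage (f k) ∪ G (char (stage (f k)))) x

    layer : Ord K → Pred X b
    layer i = G (char (stage i))

    private
      base : ∀ j → X₀ ⊆ stage j
      base (sup _ _) = inj₁

      mono : ∀ i j → i ≤ j → stage i ⊆ stage j
      step : ∀ i j → i < j → (stage i ∪ layer i) ⊆ stage j

      mono (sup _ f) j i≤j (inj₁ p)       = base j p
      mono (sup _ f) j i≤j (inj₂ (k , p)) = step (f k) j (i≤j k) p

      step i (sup _ g) (k , i≤g) (inj₁ p) = inj₂ (k , inj₁ (mono i (g k) i≤g p))
      step i (sup _ g) (k , i≤g) {x} (inj₂ p) with ≤-⊎-> (g k) i
      ... | inj₂ i<g = inj₂ (k , inj₁ (step i (g k) i<g (inj₂ p)))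
      -- Here `i` and `g k` are equivalent, so `G` receives the same characteristic function at
      -- both.
      ... | inj₁ g≤i = inj₂ (k , inj₂ (subst (λ c → G c x)
              (char-cong (mono i (g k) i≤g , mono (g k) i g≤i)) p))

    -- Stated for any `H`, because a second choice made from the same stages will single out a
    -- subset of each layer.
    char-stage-cong : (H : (X → Bool) → Pred X b) → ∀ {i j} → i ≤ j → j ≤ i →
                      H (char (stage i)) ⊆ H (char (stage j))
    char-stage-cong H {i} {j} i≤j j≤i {x} =
      subst (λ c → H c x) (char-cong (mono i j i≤j , mono j i j≤i))

    open Chain X₀ layer (char-stage-cong G) public

    stage≐U : ∀ i → stage i ≐ U i
    stage≐U i = to i , from i
      where
      to : ∀ i → stage i ⊆ U i
      to (sup _ f) (inj₁ p) = inj₁ p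
      to (sup _ f) (inj₂ (k , inj₁ p)) = U-mono (<⇒≤ (k , ≤-refl (f k))) (to (f k) p)
      to (sup _ f) (inj₂ (k , inj₂ p)) = inj₂ (f k , (k , ≤-refl (f k)) , p)

      from : ∀ i → U i ⊆ stage i
      from i (inj₁ p) = base i p
      from i (inj₂ (j , j<i , p)) = step j i j<i (inj₂ p)

-- Automorphisms acting on subsets and algebraic closures

module Automorphisms {L : Signature} (𝔐 : Structure L (suc 0ℓ)) where
  open Signature L
  open Syntax L
  open Structure 𝔐
  open Semantics 𝔐
  open BigModel 𝔐
  open Automorphism

  private variable
    A B C X Y : Subset

  from : Automorphism → ∀ {s} → Carrier s → Carrier s
  from σ {s} = Inverse.from (bij σ s)

  to-from : ∀ σ {s} (x : Carrier s) → to σ (from σ x) ≡ x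
  to-from σ {s} = Inverse.strictlyInverseˡ (bij σ s)

  from-to : ∀ σ {s} (x : Carrier s) → from σ (to σ x) ≡ x
  from-to σ {s} = Inverse.strictlyInverseʳ (bij σ s)

  to-injective : ∀ σ {s} {x y : Carrier s} → to σ x ≡ to σ y → x ≡ y
  to-injective σ {x = x} {y} eq =
    trans (sym (from-to σ x)) (trans (cong (from σ) eq) (from-to σ y))

  map-to-from : ∀ σ {Γ} (xs : All Carrier Γ) → All.map (to σ) (All.map (from σ) xs) ≡ xs
  map-to-from σ []       = refl
  map-to-from σ (x ∷ xs) = cong₂ _∷_ (to-from σ x) (map-to-from σ xs)

  idᴬ : Automorphism
  idᴬ .bij s         = ↔-refl
  idᴬ .fun-pres f xs = cong (fun f) (sym (All.map-id xs))
  idᴬ .rel-pres R xs = mk⇔ (subst (rel R) (sym (All.map-id xs))) (subst (rel R) (All.map-id xs))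

  infix 9 _⁻¹
  _⁻¹ : Automorphism → Automorphism
  (σ ⁻¹) .bij s = ↔-sym (bij σ s)
  (σ ⁻¹) .fun-pres f xs =
    trans (cong (λ ys → from σ (fun f ys)) (sym (map-to-from σ xs)))
    (trans (cong (from σ) (sym (fun-pres σ f (All.map (from σ) xs))))
           (from-to σ _))
  (σ ⁻¹) .rel-pres R xs = mk⇔
    (λ r → Equivalence.from (rel-pres σ R _) (subst (rel R) (sym (map-to-from σ xs)) r))
    (λ r → subst (rel R) (map-to-from σ xs) (Equivalence.to (rel-pres σ R _) r))

  act-act⁻¹ : ∀ σ x → act σ (act (σ ⁻¹) x) ≡ x
  act-act⁻¹ σ (s , a) = cong (s ,_) (to-from σ a)

  act⁻¹-act : ∀ σ x → act (σ ⁻¹) (act σ x) ≡ x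
  act⁻¹-act σ = act-act⁻¹ (σ ⁻¹)

  act-injective : ∀ σ {x y} → act σ x ≡ act σ y → x ≡ y
  act-injective σ {x} {y} eq =
    trans (sym (act⁻¹-act σ x)) (trans (cong (act (σ ⁻¹)) eq) (act⁻¹-act σ y))

  -- Preimages replace images: membership then unfolds without an existential, and `⋆` commutes with
  -- unions definitionally.
  infixr 8 _⋆_
  _⋆_ : Automorphism → Subset → Subset
  (σ ⋆ A) x = act σ x ∈ A

  Fixes : Automorphism → Subset → Set₁
  Fixes σ B = ∀ x → x ∈ B → act σ x ≡ x

  ⋆-cong : ∀ σ → A ≐ B → σ ⋆ A ≐ σ ⋆ B
  ⋆-cong σ (A⊆B , B⊆A) = A⊆B , B⊆A

  ⁻¹⋆⋆ : ∀ σ → σ ⁻¹ ⋆ σ ⋆ A ≐ A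
  ⁻¹⋆⋆ {A} σ = subst A (act-act⁻¹ σ _) , subst A (sym (act-act⁻¹ σ _))

  ⋆-adjoint : ∀ σ → A ≐ σ ⋆ B → σ ⁻¹ ⋆ A ≐ B
  ⋆-adjoint σ A≐σB = ≐-trans (⋆-cong (σ ⁻¹) A≐σB) (⁻¹⋆⋆ σ)

  Fixes-⊆ : ∀ σ → A ⊆ B → Fixes σ B → Fixes σ A
  Fixes-⊆ σ A⊆B fix x x∈A = fix x (A⊆B x∈A)

  Fixes-⁻¹ : ∀ σ → Fixes σ B → Fixes (σ ⁻¹) B
  Fixes-⁻¹ σ fix x x∈B = trans (cong (act (σ ⁻¹)) (sym (fix x x∈B))) (act⁻¹-act σ x)

  Fixes⇒⋆ : ∀ σ → Fixes σ B → σ ⋆ B ≐ B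
  Fixes⇒⋆ {B} σ fix =
    (λ {x} p → subst B (act-injective σ (fix (act σ x) p)) p) ,
    (λ {x} p → subst B (sym (fix x p)) p)

  MapsOnto⇒⋆ : ∀ σ → σ MapsOnto A , B → A ≐ σ ⋆ B
  MapsOnto⇒⋆ {A} σ (f , g) =
    (λ p → f (_ , p , refl)) ,
    (λ p → let _ , q , eq = g p in subst A (act-injective σ eq) q)

  ⋆⇒MapsOnto : ∀ σ → A ≐ σ ⋆ B → σ MapsOnto A , B
  ⋆⇒MapsOnto {A} {B} σ (f , g) =
    (λ { (_ , p , refl) → f p }) ,
    (λ {y} p → act (σ ⁻¹) y , g (subst B (sym (act-act⁻¹ σ y)) p) , act-act⁻¹ σ y)

  ≡[]⇒⋆ : ((σ , _) : A ≡[ C ] B) → A ≐ σ ⋆ B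
  ≡[]⇒⋆ (σ , _ , onto) = MapsOnto⇒⋆ σ onto

  mutual
    eval-pres : ∀ σ {Γ s} (t : Term Γ s) (ρ : All Carrier Γ) →
                to σ (eval t ρ) ≡ eval t (All.map (to σ) ρ)
    eval-pres σ (var i)    ρ = sym (All.lookup-map ρ i)
    eval-pres σ (app f ts) ρ = trans (fun-pres σ f _) (cong (fun f) (evals-pres σ ts ρ))

    evals-pres : ∀ σ {Γ Δ} (ts : All (Term Γ) Δ) (ρ : All Carrier Γ) →
                 All.map (to σ) (evals ts ρ) ≡ evals ts (All.map (to σ) ρ)
    evals-pres σ []       ρ = refl
    evals-pres σ (t ∷ ts) ρ = cong₂ _∷_ (eval-pres σ t ρ) (evals-pres σ ts ρ)

  ⟦⟧-pres : ∀ σ {Γ} (φ : Formula Γ) (ρ : All Carrier Γ) →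
            ⟦ φ ⟧ ρ ⇔ ⟦ φ ⟧ (All.map (to σ) ρ)
  ⟦⟧-pres σ false ρ = mk⇔ id id
  ⟦⟧-pres σ (t ≈ u) ρ = mk⇔
    (λ eq → trans (sym (eval-pres σ t ρ)) (trans (cong (to σ) eq) (eval-pres σ u ρ)))
    (λ eq → to-injective σ (trans (eval-pres σ t ρ) (trans eq (sym (eval-pres σ u ρ)))))
  ⟦⟧-pres σ (atom R ts) ρ = mk⇔
    (λ r → subst (rel R) (evals-pres σ ts ρ) (Equivalence.to (rel-pres σ R _) r))
    (λ r → Equivalence.from (rel-pres σ R _) (subst (rel R) (sym (evals-pres σ ts ρ)) r))
  ⟦⟧-pres σ (φ ⇒ ψ) ρ = mk⇔
    (λ h p → Equivalence.to (⟦⟧-pres σ ψ ρ) (h (Equivalence.from (⟦⟧-pres σ φ ρ) p)))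
    (λ h p → Equivalence.from (⟦⟧-pres σ ψ ρ) (h (Equivalence.to (⟦⟧-pres σ φ ρ) p)))
  ⟦⟧-pres σ (all s φ) ρ = mk⇔
    (λ h a → subst (λ x → ⟦ φ ⟧ (x ∷ All.map (to σ) ρ)) (to-from σ a)
               (Equivalence.to (⟦⟧-pres σ φ (from σ a ∷ ρ)) (h (from σ a))))
    (λ h a → Equivalence.from (⟦⟧-pres σ φ (a ∷ ρ)) (h (to σ a)))

  acl-mono : A ⊆ B → acl A ⊆ acl B
  acl-mono A⊆B (φ , over , alg) = φ , (λ i → A⊆B (over i)) , alg

  acl-cong : A ≐ B → acl A ≐ acl B
  acl-cong {A} {B} (A⊆B , B⊆A) = acl-mono {A} {B} A⊆B , acl-mono {B} {A} B⊆A

  ⊆acl : A ⊆ acl A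
  ⊆acl {x = s , a} p =
    (s ∷ [] , var (here refl) ≈ var (there (here refl)) , a ∷ []) ,
    (λ { (here refl) → p }) , refl , a ∷ [] , λ _ → here

  act-acl : ∀ σ {x} → x ∈ acl (σ ⋆ A) → act σ x ∈ acl A
  act-acl {A} σ {s , a} ((Γ , φ , b) , over , sat , xs , xs-all) =
    (Γ , φ , All.map (to σ) b) ,
    (λ i → subst (λ c → (_ , c) ∈ A) (sym (All.lookup-map b i)) (over i)) ,
    Equivalence.to (⟦⟧-pres σ φ (a ∷ b)) sat ,
    map (to σ) xs ,
    λ y sat-y → subst (_∈ₗ map (to σ) xs) (to-from σ y) (∈-map⁺ (to σ) (xs-all (from σ y)
      (Equivalence.from (⟦⟧-pres σ φ (from σ y ∷ b))
        (subst (λ z → ⟦ φ ⟧ (z ∷ All.map (to σ) b)) (sym (to-from σ y)) sat-y))))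

  ⋆-acl : ∀ σ → σ ⋆ acl A ≐ acl (σ ⋆ A)
  ⋆-acl {A} σ =
    (λ {x} p → subst (acl (σ ⋆ A)) (act⁻¹-act σ x)
      (act-acl {σ ⋆ A} (σ ⁻¹) (proj₂ (acl-cong {σ ⁻¹ ⋆ σ ⋆ A} {A} (⁻¹⋆⋆ {A} σ)) p))) ,
    act-acl {A} σ

  Fixes⇒⋆-acl : ∀ σ → Fixes σ B → σ ⋆ acl B ≐ acl B
  Fixes⇒⋆-acl {B} σ fix = ≐-trans (⋆-acl {B} σ) (acl-cong {σ ⋆ B} {B} (Fixes⇒⋆ σ fix))

  parameters : ∀ {Γ} → All Carrier Γ → List Element
  parameters []      = []
  parameters (c ∷ b) = (_ , c) ∷ parameters b

  -- The generators are returned as a list that may be placed in any other set, so that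
  -- `Chain.finite` can push them down to an earlier stage.
  acl-finite : ∀ {x} → x ∈ acl X →
               ∃[ ps ] All X ps × (∀ {Y : Subset} → All Y ps → x ∈ acl Y)
  acl-finite ((Γ , φ , b) , over , alg) =
    parameters b , to-All b over , λ all → (Γ , φ , b) , from-All b all , alg
    where
    to-All : ∀ {Γ} (b : All Carrier Γ) →
             (∀ {t} (i : t ∈ₗ Γ) → (t , All.lookup b i) ∈ X) → All X (parameters b)
    to-All []      over = []
    to-All (c ∷ b) over = over (here refl) ∷ to-All b (over ∘ there)

    from-All : ∀ {Γ} (b : All Carrier Γ) → All Y (parameters b) →
               ∀ {t} (i : t ∈ₗ Γ) → (t , All.lookup b i) ∈ Y
    from-All (c ∷ b) (p ∷ _)  (here refl) = p
    from-All (c ∷ b) (_ ∷ ps) (there i)   = from-All b ps i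

-- Small sets and representatives of conjugates

module Smallness (em : ∀ {a} → ExcludedMiddle a) (ext : ∀ {a b} → Extensionality a b)
                 {L : Signature} (𝔐 : Structure L (suc 0ℓ)) where
  open Signature L
  open Syntax L
  open Structure 𝔐
  open Semantics 𝔐
  open BigModel 𝔐
  open Automorphism
  open Automorphisms 𝔐
  open Classical em ext

  private variable
    A B C : Subset

  Covered : Subset → Set₁
  Covered A = Σ[ I ∈ Set ] Σ[ e ∈ (I → Element) ] (∀ {x} → x ∈ A → ∃[ i ] e i ≡ x)

  -- Unlike Small, whose definition unfolds, this record lets Agda read off A.
  record IsSmall (A : Subset) : Set₁ where
    constructor small
    field unsmall : Small A
  open IsSmall public

  covered⇒small : Covered A → IsSmall A
  covered⇒small {A} (I , e , cover) = small (
    (Σ[ i ∈ I ] T ⌊ e i ∈ A ⌋) , record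
      { to         = λ (i , p) → e i , ⌊⌋⁻ p
      ; cong       = λ { refl → refl }
      ; surjective = λ (x , p) → let i , eq = cover p in
          (i , ⌊⌋⁺ (subst A (sym eq) p)) , λ { refl → eq }
      })

  small⇒covered : IsSmall A → Covered A
  small⇒covered (small (I , S)) =
    I , proj₁ ∘ Surjection.to S , λ {x} p → Surjection.to⁻ S (x , p) , Surjection.to∘to⁻ S (x , p)

  small-⊆ : A ⊆ B → IsSmall B → IsSmall A
  small-⊆ A⊆B sB = let I , e , cover = small⇒covered sB in
    covered⇒small (I , e , cover ∘ A⊆B)

  small-≐ : A ≐ B → IsSmall A → IsSmall B
  small-≐ (_ , B⊆A) = small-⊆ B⊆A

  small-⋃ : (J : Set) {F : J → Subset} → (∀ j → IsSmall (F j)) → IsSmall (⋃ J F)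
  small-⋃ J {F} s = covered⇒small
    ((Σ[ j ∈ J ] proj₁ (small⇒covered (s j))) ,
     (λ (j , i) → proj₁ (proj₂ (small⇒covered (s j))) i) ,
     λ (j , p) → let i , eq = proj₂ (proj₂ (small⇒covered (s j))) p in (j , i) , eq)

  small-∪ : IsSmall A → IsSmall B → IsSmall (A ∪ B)
  small-∪ sA sB =
    let I , e , cover = small⇒covered sA
        J , f , cover′ = small⇒covered sB
    in covered⇒small ((I ⊎ J) , [ e , f ]′ ,
         λ { (inj₁ p) → let i , eq = cover p in inj₁ i , eq
           ; (inj₂ p) → let j , eq = cover′ p in inj₂ j , eq })

  small-⋆ : ∀ σ → IsSmall A → IsSmall (σ ⋆ A)
  small-⋆ σ sA = let I , e , cover = small⇒covered sA in
    covered⇒small (I , act (σ ⁻¹) ∘ e ,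
      λ {x} p → let i , eq = cover p in i , trans (cong (act (σ ⁻¹)) eq) (act⁻¹-act σ x))

  small-∅ : IsSmall ∅
  small-∅ = covered⇒small (⊥ , (λ ()) , λ ())

  -- An algebraic element is coded by a formula, the indices of its parameters and a position in a
  -- list of solutions, all of which live in `Set`.
  small-acl : IsSmall A → IsSmall (acl A)
  small-acl {A} sA = covered⇒small (Index , element , λ {x} → cover′ {x})
    where
    I = proj₁ (small⇒covered sA)
    e = proj₁ (proj₂ (small⇒covered sA))
    cover = proj₂ (proj₂ (small⇒covered sA))

    Parameter : Sort → Set
    Parameter t = Σ[ i ∈ I ] proj₁ (e i) ≡ t

    value : ∀ {t} → Parameter t → Carrier t
    value (i , eq) = subst Carrier eq (proj₂ (e i))

    solutions : ∀ {s} → Formulaᴹ s → List (Carrier s)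
    solutions φ with em {P = Σ[ xs ∈ List _ ] (∀ x → Sat x φ → x ∈ₗ xs)}
    ... | yes (xs , _) = xs
    ... | no _         = []

    solutions-complete : ∀ {s} (φ : Formulaᴹ s) →
      Σ[ xs ∈ List _ ] (∀ x → Sat x φ → x ∈ₗ xs) → ∀ x → Sat x φ → x ∈ₗ solutions φ
    solutions-complete φ alg with em {P = Σ[ xs ∈ List _ ] (∀ x → Sat x φ → x ∈ₗ xs)}
    ... | yes (_ , complete) = complete
    ... | no ¬alg            = ⊥-elim (¬alg alg)

    Index : Set
    Index = Σ[ s ∈ Sort ] Σ[ Γ ∈ List Sort ] Σ[ φ ∈ Formula (s ∷ Γ) ]
            Σ[ ps ∈ All Parameter Γ ] Fin (length (solutions (Γ , φ , All.map value ps)))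

    element : Index → Element
    element (s , Γ , φ , ps , n) = s , lookup (solutions (Γ , φ , All.map value ps)) n

    parameter : ∀ {t} (c : Carrier t) → (t , c) ∈ A → Σ[ p ∈ Parameter t ] value p ≡ c
    parameter c p with cover p
    ... | i , refl = (i , refl) , refl

    parametrise : ∀ {Γ} (b : All Carrier Γ) →
                  (∀ {t} (i : t ∈ₗ Γ) → (t , All.lookup b i) ∈ A) →
                  Σ[ ps ∈ All Parameter Γ ] All.map value ps ≡ b
    parametrise []      over = [] , refl
    parametrise (c ∷ b) over =
      let p , eq = parameter c (over (here refl))
          ps , eqs = parametrise b (over ∘ there)
      in p ∷ ps , cong₂ _∷_ eq eqs

    cover′ : ∀ {x} → x ∈ acl A → ∃[ n ] element n ≡ x
    cover′ {s , a} ((Γ , φ , b) , over , sat , alg) with parametrise b over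
    ... | ps , refl =
      let a∈ = solutions-complete (Γ , φ , All.map value ps) alg a sat
      in (s , Γ , φ , ps , index a∈) , cong (s ,_) (sym (lookup-index a∈))

  finite-list : Finite A → Σ[ xs ∈ List Element ] All A xs × (∀ {x} → x ∈ A → x ∈ₗ xs)
  finite-list {A} (xs , cover) =
    filter A? xs , All.all-filter A? xs , λ p → ∈-filter⁺ A? (cover p) p
    where
    A? : ∀ x → Dec (x ∈ A)
    A? x = em

  abstract
    -- The step of `Iterate` needs a value at every characteristic function. All stages that arise
    -- are small, so the default ∅ is never met there.
    whenSmall : (S : Subset) → (IsSmall S → Subset) → Subset
    whenSmall S F = [ F , (λ _ → ∅) ]′ (toSum (em {P = IsSmall S}))

    whenSmall-elim : ∀ {p S} {F : IsSmall S → Subset} (P : Subset → Set p) →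
                     IsSmall S → (∀ s → P (F s)) → P (whenSmall S F)
    whenSmall-elim {S = S} P sS h with em {P = IsSmall S}
    ... | yes s = h s
    ... | no ¬s = ⊥-elim (¬s sS)

    -- Both sides receive the same proof of smallness, on which the choices inside `F` and `F′` may
    -- depend.
    whenSmall-mono : ∀ S {F F′ : IsSmall S → Subset} →
                     (∀ s → F s ⊆ F′ s) → whenSmall S F ⊆ whenSmall S F′
    whenSmall-mono S F⊆F′ with em {P = IsSmall S}
    ... | yes s = F⊆F′ s
    ... | no _  = id

    small-whenSmall : ∀ S (F : IsSmall S → Subset) →
                      (∀ s → IsSmall (F s)) → IsSmall (whenSmall S F)
    small-whenSmall S F sF with em {P = IsSmall S}
    ... | yes s = sF s
    ... | no _  = small-∅

  -- Up to automorphisms fixing D, a conjugate of A is determined by the type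
  -- over D of an enumeration, and such types form a small set.
  module Conjugates (homogeneous : StronglyHomogeneous)
                    {A D : Subset} (sA : IsSmall A) (sD : IsSmall D) where

    private
      I = proj₁ (small⇒covered sA)
      J = proj₁ (small⇒covered sD)
      e = proj₁ (proj₂ (small⇒covered sA))
      cover = proj₂ (proj₂ (small⇒covered sA))
      f = proj₁ (proj₂ (small⇒covered sD))
      coverD = proj₂ (proj₂ (small⇒covered sD))

      sort : I ⊎ J → Sort
      sort = [ proj₁ ∘ e , proj₁ ∘ f ]′

      tuple : Automorphism → ∀ i → Carrier (sort i)
      tuple σ (inj₁ i) = from σ (proj₂ (e i))
      -- Listing D unmoved beside the conjugate turns types over D into parameter-free types, as
      -- homogeneity requires.
      tuple σ (inj₂ j) = proj₂ (f j)

    Type : Set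
    Type = (is : List (I ⊎ J)) → Formula (map sort is) → Bool

    type : Automorphism → Type
    type σ is φ = ⌊ ⟦ φ ⟧ (All.map⁺ (All.universal (tuple σ) is)) ⌋

    rep : Type → Automorphism
    rep t with em {P = ∃[ σ ] type σ ≡ t}
    ... | yes (σ , _) = σ
    ... | no _        = idᴬ

    type-rep : ∀ σ → type (rep (type σ)) ≡ type σ
    type-rep σ with em {P = ∃[ σ′ ] type σ′ ≡ type σ}
    ... | yes (_ , eq) = eq
    ... | no ¬p        = ⊥-elim (¬p (σ , refl))

    conjugate : ∀ σ → Σ[ τ ∈ Automorphism ] Fixes τ D × σ ⋆ A ≐ τ ⋆ rep (type σ) ⋆ A
    conjugate σ = τ , fix , (λ {x} → into {x}) , (λ {x} → outof {x})
      where
      ρ = rep (type σ)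

      same : ∀ is φ → type σ is φ ≡ type ρ is φ
      same is φ = cong (λ t → t is φ) (sym (type-rep σ))

      extended : Σ[ τ ∈ Automorphism ] (∀ i → to τ (tuple σ i) ≡ tuple ρ i)
      extended = homogeneous (I ⊎ J) sort (tuple σ) (tuple ρ) λ is φ → mk⇔
        (λ p → ⌊⌋⁻ (subst T (same is φ) (⌊⌋⁺ p)))
        (λ p → ⌊⌋⁻ (subst T (sym (same is φ)) (⌊⌋⁺ p)))

      τ = proj₁ extended

      fix : Fixes τ D
      fix x p with coverD p
      ... | j , refl = cong (_ ,_) (proj₂ extended (inj₂ j))

      τσ⁻¹ : ∀ {y} → y ∈ A → act τ (act (σ ⁻¹) y) ≡ act (ρ ⁻¹) y
      τσ⁻¹ p with cover p
      ... | i , refl = cong (_ ,_) (proj₂ extended (inj₁ i))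

      into : σ ⋆ A ⊆ τ ⋆ ρ ⋆ A
      into {x} p = subst A (trans (sym (act-act⁻¹ ρ _))
        (cong (act ρ) (trans (sym (τσ⁻¹ p)) (cong (act τ) (act⁻¹-act σ x))))) p

      outof : τ ⋆ ρ ⋆ A ⊆ σ ⋆ A
      outof {x} p = subst A (trans (sym (act-act⁻¹ σ _)) (cong (act σ)
        (act-injective τ (trans (τσ⁻¹ p) (act⁻¹-act ρ (act τ x)))))) p

-- Derived rules for independence relations

module Independence (em : ∀ {a} → ExcludedMiddle a) (ext : ∀ {a b} → Extensionality a b)
                    {L : Signature} (𝔐 : Structure L (suc 0ℓ))
                    {ℓ} (_⊥[_]_ : BigModel.TernaryRelation 𝔐 ℓ)
                    (isIndependenceRelation : BigModel.IsIndependenceRelation 𝔐 _⊥[_]_) where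
  open BigModel 𝔐
  private module ⊥ = IsIndependenceRelation isIndependenceRelation
  open Automorphism using (act)
  open Automorphisms 𝔐
  open Classical em ext
  open Smallness em ext 𝔐

  private variable
    A A′ B B′ C C′ C₀ : Subset

  transport : ∀ σ → IsSmall A → IsSmall B → IsSmall C →
              A′ ≐ σ ⋆ A → B′ ≐ σ ⋆ B → C′ ≐ σ ⋆ C → A ⊥[ C ] B → A′ ⊥[ C′ ] B′
  transport σ sA sB sC eA eB eC ind = ⊥.invariance (unsmall sA) (unsmall sB) (unsmall sC)
    (unsmall (small-≐ (≐-sym eA) (small-⋆ σ sA)))
    (unsmall (small-≐ (≐-sym eB) (small-⋆ σ sB)))
    (unsmall (small-≐ (≐-sym eC) (small-⋆ σ sC)))
    ind (σ , ⋆⇒MapsOnto σ eA , ⋆⇒MapsOnto σ eB , ⋆⇒MapsOnto σ eC)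

  respects : IsSmall A → IsSmall B → IsSmall C →
             A′ ≐ A → B′ ≐ B → C′ ≐ C → A ⊥[ C ] B → A′ ⊥[ C′ ] B′
  respects = transport idᴬ

  mono : IsSmall A → IsSmall B → IsSmall C →
         A′ ⊆ A → B′ ⊆ B → A ⊥[ C ] B → A′ ⊥[ C ] B′
  mono sA sB sC A′⊆A B′⊆B ind = ⊥.monotonicity (unsmall sA) (unsmall sB) (unsmall sC)
    (unsmall (small-⊆ A′⊆A sA)) (unsmall (small-⊆ B′⊆B sB)) ind A′⊆A B′⊆B

  base-mono : IsSmall A → IsSmall B → IsSmall C →
              C₀ ⊆ C → C ⊆ B → A ⊥[ C₀ ] B → A ⊥[ C ] B
  base-mono sA sB sC C₀⊆C = ⊥.base-monotonicity
    (unsmall sA) (unsmall sB) (unsmall sC) (unsmall (small-⊆ C₀⊆C sC)) C₀⊆C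

  transitive : IsSmall A → IsSmall B → IsSmall C → C₀ ⊆ C →
               B ⊥[ C ] A → C ⊥[ C₀ ] A → (B ∪ C) ⊥[ C₀ ] A
  transitive sA sB sC C₀⊆C B⊥A = ⊥.transitivity
    (unsmall sA) (unsmall (small-∪ sB sC)) (unsmall sC) (unsmall (small-⊆ C₀⊆C sC)) C₀⊆C inj₂
    (⊥.normality (unsmall sB) (unsmall sA) (unsmall sC) B⊥A)

  normality : IsSmall A → IsSmall B → IsSmall C → A ⊥[ C ] B → (A ∪ C) ⊥[ C ] B
  normality sA sB sC = ⊥.normality (unsmall sA) (unsmall sB) (unsmall sC)

  -- The axiom moves A; the inverse automorphism lets A stay and moves `B′` instead.
  extension : IsSmall A → IsSmall B → IsSmall C → IsSmall B′ → B ⊆ B′ → A ⊥[ C ] B →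
              Σ[ σ ∈ Automorphism ] Fixes σ (B ∪ C) × A ⊥[ C ] (σ ⋆ B′)
  extension {A} {B} {C} {B′} sA sB sC sB′ B⊆B′ ind =
    back (⊥.extension (unsmall sA) (unsmall sB) (unsmall sC) (unsmall sB′) ind B⊆B′)
    where
    back : ∃[ A′ ] A′ ≡[ B ∪ C ] A × A′ ⊥[ C ] B′ →
           Σ[ σ ∈ Automorphism ] Fixes σ (B ∪ C) × A ⊥[ C ] (σ ⋆ B′)
    back (A′ , A′≡A@(σ , fix , _) , ind′) =
      σ ⁻¹ , fix⁻¹ ,
      transport (σ ⁻¹) (small-≐ (≐-sym A′≐σA) (small-⋆ σ sA)) sB′ sC
        (≐-sym (⋆-adjoint {A′} {A} σ A′≐σA)) ≐-refl
        (≐-sym (Fixes⇒⋆ {C} (σ ⁻¹) (Fixes-⊆ (σ ⁻¹) inj₂ fix⁻¹))) ind′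
      where
      A′≐σA : A′ ≐ σ ⋆ A
      A′≐σA = ≡[]⇒⋆ {A′} {B ∪ C} {A} A′≡A

      fix⁻¹ : Fixes (σ ⁻¹) (B ∪ C)
      fix⁻¹ = Fixes-⁻¹ {B ∪ C} σ fix

  local-character : IsSmall A → Σ[ κ ∈ Set ] (∀ {B} → IsSmall B →
                    ∃[ C ] C ⊆ B × ∣ C ∣< κ × A ⊥[ C ] B)
  local-character sA = proj₁ (⊥.local-character (unsmall sA)) ,
    λ sB → proj₂ (⊥.local-character (unsmall sA)) (unsmall sB)

  -- Extension only moves `B′` by an automorphism fixing `B ∪ C`, which here changes nothing.
  extend-invariant : IsSmall A → IsSmall B → IsSmall C → IsSmall B′ → B ⊆ B′ →
    (∀ σ → Fixes σ (B ∪ C) → σ ⋆ B′ ≐ B′) → A ⊥[ C ] B → A ⊥[ C ] B′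
  extend-invariant sA sB sC sB′ B⊆B′ B′-inv ind =
    let σ , fix , ind′ = extension sA sB sC sB′ B⊆B′ ind in
    respects sA (small-⋆ σ sB′) sC ≐-refl (≐-sym (B′-inv σ fix)) ≐-refl ind′

  extend-base : IsSmall A → IsSmall B → IsSmall C → A ⊥[ C ] B → A ⊥[ C ] (B ∪ C)
  extend-base {B = B} {C} sA sB sC =
    extend-invariant sA sB sC (small-∪ sB sC) inj₁ (λ σ → Fixes⇒⋆ {B ∪ C} σ)

  extend-acl : IsSmall A → IsSmall B → IsSmall C → A ⊥[ C ] B → A ⊥[ C ] acl (B ∪ C)
  extend-acl {B = B} {C} sA sB sC =
    extend-invariant sA sB sC (small-acl (small-∪ sB sC)) (λ p → ⊆acl {A = B ∪ C} (inj₁ p))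
      (λ σ → Fixes⇒⋆-acl {B ∪ C} σ)

  existence : IsSmall A → IsSmall C → A ⊥[ C ] C
  existence sA sC =
    let _ , Z⊆C , _ , ind = proj₂ (local-character sA) sC in
    base-mono sA sC sC Z⊆C id ind

  -- Symmetry

  -- Build a long sequence of conjugates σ i ⋆ A of A over B ∪ C such that the
  -- stage U i, consisting of C and the earlier conjugates, is independent over
  -- C from B ∪ σ i ⋆ A.  By local character B is independent over some stage
  -- U i from everything, so transitivity gives B ⊥[ C ] (σ i ⋆ A).
  module Symmetry {A B C} (sA : IsSmall A) (sB : IsSmall B) (sC : IsSmall C)
                  (A⊥B : A ⊥[ C ] B) where

    Good : Subset → Automorphism → Set _
    Good S σ = Fixes σ (B ∪ C) × S ⊥[ C ] (B ∪ σ ⋆ A)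

    good-exists : ∀ {S} → IsSmall S → S ⊥[ C ] B → ∃ (Good S)
    good-exists sS S⊥B =
      let σ , fix , ind = extension sS sB sC (small-∪ sB sA) inj₁ S⊥B
          B≐ = Fixes⇒⋆ {B} σ (Fixes-⊆ {B} {B ∪ C} σ inj₁ fix)
      in σ , fix , respects sS (small-⋆ σ (small-∪ sB sA)) sC ≐-refl
           (Sum.map₁ (proj₂ B≐) , Sum.map₁ (proj₁ B≐)) ≐-refl ind

    choose : (Element → Bool) → Automorphism
    choose c = [ proj₁ , (λ _ → idᴬ) ]′ (toSum (em {P = ∃ (Good (decode c))}))

    choose-good : ∀ c → ∃ (Good (decode c)) → Good (decode c) (choose c)
    choose-good c good = chosen (em {P = ∃ (Good (decode c))})
      where
      chosen : (d : Dec (∃ (Good (decode c)))) →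
               Good (decode c) ([ proj₁ , (λ _ → idᴬ) ]′ (toSum d))
      chosen (yes (_ , good′)) = good′
      chosen (no ¬good)        = ⊥-elim (¬good good)

    κ : Set
    κ = proj₁ (local-character sB)

    open Iterate κ C (λ c → choose c ⋆ A)

    σ : Ord κ → Automorphism
    σ i = choose (char (stage i))

    small-layer : ∀ i → IsSmall (layer i)
    small-layer i = small-⋆ (σ i) sA

    small-U∞ : IsSmall U∞
    small-U∞ = small-∪ sC (small-⋃ (Ord κ) small-layer)

    small-U : ∀ i → IsSmall (U i)
    small-U i = small-⊆ (U⊆U∞ i) small-U∞

    U≐ : ∀ i → decode (char (stage i)) ≐ U i
    U≐ i = ≐-trans (decode-char {S = stage i}) (stage≐U i)

    good : ∀ i → U i ⊥[ C ] B → Good (U i) (σ i)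
    good i Ui⊥B = proj₁ found ,
      respects sUi (small-∪ sB (small-layer i)) sC (≐-sym (U≐ i)) ≐-refl ≐-refl (proj₂ found)
      where
      sUi : IsSmall (decode (char (stage i)))
      sUi = small-≐ (≐-sym (U≐ i)) (small-U i)

      found : Good (decode (char (stage i))) (σ i)
      found = choose-good _ (good-exists sUi
        (respects (small-U i) sB sC (U≐ i) ≐-refl ≐-refl Ui⊥B))

    layer⊥B : ∀ i → Fixes (σ i) (B ∪ C) → layer i ⊥[ C ] B
    layer⊥B i fix = transport (σ i) sA sB sC ≐-refl
      (≐-sym (Fixes⇒⋆ {B} (σ i) (Fixes-⊆ {B} {B ∪ C} (σ i) inj₁ fix)))
      (≐-sym (Fixes⇒⋆ {C} (σ i) (Fixes-⊆ {C} {B ∪ C} (σ i) inj₂ fix))) A⊥B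

    -- Transitivity through the base `layer i ∪ C`: base monotonicity shifts the new conjugate from
    -- the right side of `Good` into the base.
    next : ∀ i → U i ⊥[ C ] B → (U i ∪ layer i) ⊥[ C ] B
    next i Ui⊥B = mono (small-∪ sU slC) sB sC (Sum.map₂ inj₁) id
      (transitive sB sU slC inj₂ U⊥B
        (normality sl sB sC (layer⊥B i (proj₁ (good i Ui⊥B)))))
      where
      sU = small-U i
      sl = small-layer i
      slC = small-∪ sl sC
      sBl = small-∪ sB sl

      U⊥B : U i ⊥[ layer i ∪ C ] B
      U⊥B = mono sU (small-∪ sBl sC) slC id (λ p → inj₁ (inj₁ p))
              (base-mono sU (small-∪ sBl sC) slC inj₂ (Sum.map₁ inj₂)
                (extend-base sU sBl sC (proj₂ (good i Ui⊥B))))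

    U⊥B : ∀ i → U i ⊥[ C ] B
    U⊥B = <-rec (λ i → U i ⊥[ C ] B) λ i rec →
      ⊥.finite-character (unsmall (small-U i)) (unsmall sB) (unsmall sC)
        λ A₀ A₀-fin A₀⊆U → finite-part i rec A₀ A₀⊆U (finite-list {A₀} A₀-fin)
      where
      finite-part : ∀ i → (∀ j → j < i → U j ⊥[ C ] B) → ∀ A₀ → A₀ ⊆ U i →
        Σ[ xs ∈ List Element ] All A₀ xs × (∀ {x} → x ∈ A₀ → x ∈ₗ xs) → A₀ ⊥[ C ] B
      finite-part i rec A₀ A₀⊆U (xs , xs⊆A₀ , A₀⊆xs) = split (finite xs (All.map A₀⊆U xs⊆A₀))
        where
        split : All C xs ⊎ (∃[ j ] j < i × All (U j ∪ layer j) xs) → A₀ ⊥[ C ] B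
        -- Normality of `A⊥B` provides C ⊥[ C ] B, the start of the induction.
        split (inj₁ xs⊆C) = mono (small-∪ sA sC) sB sC
          (λ p → inj₂ (All.lookup xs⊆C (A₀⊆xs p))) id (normality sA sB sC A⊥B)
        split (inj₂ (j , j<i , xs⊆)) = mono (small-∪ (small-U j) (small-layer j)) sB sC
          (λ p → All.lookup xs⊆ (A₀⊆xs p)) id (next j (rec j j<i))

    B⊥layer : ∃[ i ] B ⊥[ U i ] layer i
    B⊥layer =
      let Z , Z⊆U∞ , (inj , _) , ind = proj₂ (local-character sB) small-U∞
          i , Z⊆U = cofinal Z Z⊆U∞ (Injection.to inj) (Injection.injective inj)
      in i , mono sB small-U∞ (small-U i) id (A⊆U∞ i)
               (base-mono sB small-U∞ (small-U i) Z⊆U (U⊆U∞ i) ind)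

    B⊥A : B ⊥[ C ] A
    B⊥A = from-layer (proj₁ B⊥layer) (proj₂ B⊥layer)
      where
      from-layer : ∀ i → B ⊥[ U i ] layer i → B ⊥[ C ] A
      from-layer i B⊥l = transport (σ i ⁻¹) sB sl sC
          (≐-sym (Fixes⇒⋆ {B} (σ i ⁻¹) (Fixes-⊆ {B} {B ∪ C} (σ i ⁻¹) inj₁ fix⁻¹)))
          (≐-sym (⁻¹⋆⋆ {A} (σ i)))
          (≐-sym (Fixes⇒⋆ {C} (σ i ⁻¹) (Fixes-⊆ {C} {B ∪ C} (σ i ⁻¹) inj₂ fix⁻¹)))
          (mono (small-∪ sB (small-U i)) sl sC inj₁ id
            (transitive sl sB (small-U i) (X₀⊆U i) B⊥l
              (mono (small-U i) (small-∪ sB sl) sC id inj₂ (proj₂ (good i (U⊥B i))))))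
        where
        sl : IsSmall (layer i)
        sl = small-layer i

        fix⁻¹ : Fixes (σ i ⁻¹) (B ∪ C)
        fix⁻¹ = Fixes-⁻¹ {B ∪ C} (σ i) (proj₁ (good i (U⊥B i)))

  symmetry : IsSmall A → IsSmall B → IsSmall C → A ⊥[ C ] B → B ⊥[ C ] A
  symmetry = Symmetry.B⊥A

  -- From `⊥` to thorn independence

  ⊥⇒⊥ᴹ : (∀ {a B} → IsSmall B → ｛ a ｝ ⊥[ B ] ｛ a ｝ → a ∈ acl B) →
          IsSmall A → IsSmall B → IsSmall C → A ⊥[ C ] B → A ⊥ᴹ[ C ] B
  ⊥⇒⊥ᴹ {A} {B} {C} anti-reflexive sA sB sC A⊥B C′ C⊆C′ C′⊆acl =
    (λ { {x} (p , q) → anti-reflexive sC′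
           (mono sBC sAC sC′ (λ { refl → q }) (λ { refl → p }) acls) }) ,
    (λ {x} p → acl-mono {C′} {A ∪ C′} inj₂ {x} p , acl-mono {C′} {B ∪ C′} inj₂ {x} p)
    where
    sacl : IsSmall (acl (B ∪ C))
    sacl = small-acl (small-∪ sB sC)

    sC′ : IsSmall C′
    sC′ = small-⊆ C′⊆acl sacl

    sAC : IsSmall (acl (A ∪ C′))
    sAC = small-acl (small-∪ sA sC′)

    sBC : IsSmall (acl (B ∪ C′))
    sBC = small-acl (small-∪ sB sC′)

    A⊥C′B : A ⊥[ C′ ] B
    -- `C′` lies only in the closure of `B ∪ C`, so the right side is closed before base
    -- monotonicity can apply.
    A⊥C′B = mono sA sacl sC′ id (λ p → ⊆acl {B ∪ C} (inj₁ p))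
      (base-mono sA sacl sC′ C⊆C′ C′⊆acl (extend-acl sA sB sC A⊥B))

    acls : acl (B ∪ C′) ⊥[ C′ ] acl (A ∪ C′)
    acls = extend-acl sBC sA sC′ (symmetry sA sBC sC′ (extend-acl sA sB sC′ A⊥C′B))

  ⊥⇒⊥þ : (∀ {a B} → IsSmall B → ｛ a ｝ ⊥[ B ] ｛ a ｝ → a ∈ acl B) →
          IsSmall A → IsSmall B → IsSmall C → A ⊥[ C ] B → A ⊥þ[ C ] B
  ⊥⇒⊥þ {A} {B} {C} anti-reflexive sA sB sC A⊥B B̂ sB̂ B⊆B̂ =
    let A′ , A′≡A , ind = ⊥.extension (unsmall sA) (unsmall sB) (unsmall sC) sB̂ A⊥B B⊆B̂
        sA′ = small-≐ (≐-sym (≡[]⇒⋆ {A′} {B ∪ C} {A} A′≡A)) (small-⋆ (proj₁ A′≡A) sA)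
    in A′ , A′≡A , ⊥⇒⊥ᴹ anti-reflexive sA′ (small sB̂) sC ind

  -- From thorn independence back to `⊥`

  -- B̂ is the union of a long chain starting from B ∪ C in which every stage D
  -- is followed by a long chain of sets, each containing representatives of all
  -- the conjugates of A over the previous one.  By local character
  -- A′ ⊥[ D ] B̂ for some stage D, and the chain after D contains conjugates R k
  -- of A′ over D ∪ X k, where X k consists of C and the R j for j < k.
  -- Applying ⊥ᴹ along this sequence gives acl (X k) ∩ acl D = acl C, and local
  -- character of D gives D ⊥[ X k ] R k for some k, hence A′ ⊥[ X k ] D.
  module Converse (homogeneous : StronglyHomogeneous)
    (intersection : ∀ {A B C₁ C₂} → IsSmall A → IsSmall B → IsSmall C₁ → IsSmall C₂ →
      C₁ ⊆ B → C₂ ⊆ B → A ⊥[ C₁ ] B → A ⊥[ C₂ ] B → A ⊥[ acl C₁ ∩ acl C₂ ] B)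
    {A B C} (sA : IsSmall A) (sB : IsSmall B) (sC : IsSmall C) where

    module Conj {D} (sD : IsSmall D) = Conjugates homogeneous sA sD

    conjugates : ∀ {D} → IsSmall D → Subset
    conjugates sD = ⋃ (Conj.Type sD) λ t → Conj.rep sD t ⋆ A

    small-conjugates : ∀ {D} → (sD : IsSmall D) → IsSmall (conjugates sD)
    small-conjugates sD = small-⋃ _ λ t → small-⋆ (Conj.rep sD t) sA

    -- The length comes from the local character of D, because D will be the left side in `D⊥R`.
    module Inner {D} (sD : IsSmall D) =
      Iterate (proj₁ (local-character sD)) D (λ c → whenSmall (decode c) conjugates)

    closure : ∀ {D} → IsSmall D → Subset
    closure sD = Inner.U∞ sD

    small-closure : ∀ {D} → (sD : IsSmall D) → IsSmall (closure sD)
    small-closure sD = small-∪ sD (small-⋃ _ λ k → small-whenSmall _ conjugates small-conjugates)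

    module Outer =
      Iterate (proj₁ (local-character sA)) (B ∪ C) (λ c → whenSmall (decode c) closure)

    B̂ : Subset
    B̂ = Outer.U∞

    sBC : IsSmall (B ∪ C)
    sBC = small-∪ sB sC

    sB̂ : IsSmall B̂
    sB̂ = small-∪ sBC (small-⋃ _ λ i → small-whenSmall _ closure small-closure)

    module _ {A′ : Subset} (ρ : Automorphism) (ρ-fixes : Fixes ρ (B ∪ C)) (A′≐ : A′ ≐ ρ ⋆ A)
             (A′⊥ᴹB̂ : A′ ⊥ᴹ[ C ] B̂) where

      sA′ : IsSmall A′
      sA′ = small-≐ (≐-sym A′≐) (small-⋆ ρ sA)

      module OverStage {D} (sD : IsSmall D) (BC⊆D : (B ∪ C) ⊆ D)
                       (closure⊆B̂ : closure sD ⊆ B̂) (A′⊥B̂ : A′ ⊥[ D ] B̂) where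

        module I = Inner sD

        S : Ord (proj₁ (local-character sD)) → Subset
        S k = decode (char (I.stage k))

        S≐U : ∀ k → S k ≐ I.U k
        S≐U k = ≐-trans (decode-char {S = I.stage k}) (I.stage≐U k)

        -- `type sS ρ` is the type of A′ over the stage, so this member of the stored
        -- representatives is conjugate to A′ over it.
        conjugate-of-A′ : ∀ {S} → IsSmall S → Subset
        conjugate-of-A′ sS = Conj.rep sS (Conj.type sS ρ) ⋆ A

        choose : (Element → Bool) → Subset
        choose c = whenSmall (decode c) conjugate-of-A′

        R : Ord (proj₁ (local-character sD)) → Subset
        R k = choose (char (I.stage k))

        R⊆layer : ∀ k → R k ⊆ I.layer k
        R⊆layer k = whenSmall-mono (S k) λ sS p → Conj.type sS ρ , p

        sR : ∀ k → IsSmall (R k)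
        sR k = small-whenSmall (S k) conjugate-of-A′
          (λ sS → small-⋆ (Conj.rep sS (Conj.type sS ρ)) sA)

        R-conjugate : ∀ k → Σ[ τ ∈ Automorphism ] Fixes τ (S k) × A′ ≐ τ ⋆ R k
        R-conjugate k = whenSmall-elim {F = conjugate-of-A′}
          (λ X → Σ[ τ ∈ Automorphism ] Fixes τ (S k) × A′ ≐ τ ⋆ X)
          (small-⊆ (λ p → closure⊆B̂ (I.U⊆U∞ k (proj₁ (S≐U k) p))) sB̂)
          (λ sS → let τ , fix , eq = Conj.conjugate sS ρ in τ , fix , ≐-trans A′≐ eq)

        τ : Ord (proj₁ (local-character sD)) → Automorphism
        τ k = proj₁ (R-conjugate k)

        -- D and the other stored conjugates are left out, so that closures of the stages can meet
        -- `acl D` in `acl C` alone. The indices stay those of `I`, so `τ k` fixes `X.U k`.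
        module X = Chain C R (λ {j} {k} → I.char-stage-cong choose {j} {k})

        X⊆U : ∀ k → X.U k ⊆ I.U k
        X⊆U k (inj₁ p)             = I.X₀⊆U k (BC⊆D (inj₂ p))
        X⊆U k (inj₂ (j , j<k , p)) = I.A⊆U j<k (R⊆layer j p)

        DX⊆U : ∀ k → (D ∪ X.U k) ⊆ I.U k
        DX⊆U k = [ I.X₀⊆U k , X⊆U k ]′

        τ-fixes : ∀ k → Fixes (τ k) (D ∪ X.U k)
        τ-fixes k = Fixes-⊆ {D ∪ X.U k} {S k} (τ k) (λ p → proj₂ (S≐U k) (DX⊆U k p))
          (proj₁ (proj₂ (R-conjugate k)))

        DX⊆B̂ : ∀ k → (D ∪ X.U k) ⊆ B̂
        DX⊆B̂ k p = closure⊆B̂ (I.U⊆U∞ k (DX⊆U k p))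

        sX∞ : IsSmall X.U∞
        sX∞ = small-∪ sC (small-⋃ _ sR)

        sX : ∀ k → IsSmall (X.U k)
        sX k = small-⊆ (X.U⊆U∞ k) sX∞

        -- The inverse of `τ k` carries `R k` to A′ and preserves `acl D` and `acl (X.U k)` as sets,
        -- though it may move x. So ⊥ᴹ, with `X.U k` as intermediate base, is applied to the image y
        -- and the result is carried back.
        acl-next : ∀ k {x} → x ∈ acl (X.U k ∪ R k) → x ∈ acl D → x ∈ acl (X.U k)
        acl-next k {x} p q = subst (acl (X.U k)) (act-act⁻¹ τₖ x) τy∈
          where
          τₖ = τ k

          y : Element
          y = act (τₖ ⁻¹) x

          fixX : Fixes τₖ (X.U k)
          fixX = Fixes-⊆ {X.U k} {D ∪ X.U k} τₖ inj₂ (τ-fixes k)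

          fixD : Fixes (τₖ ⁻¹) D
          fixD = Fixes-⁻¹ {D} τₖ (Fixes-⊆ {D} {D ∪ X.U k} τₖ inj₁ (τ-fixes k))

          XR⊆ : (X.U k ∪ R k) ⊆ (τₖ ⁻¹ ⋆ (A′ ∪ X.U k))
          XR⊆ (inj₁ p) = inj₂ (proj₂ (Fixes⇒⋆ {X.U k} (τₖ ⁻¹) (Fixes-⁻¹ {X.U k} τₖ fixX)) p)
          XR⊆ (inj₂ p) = inj₁ (proj₂ (⋆-adjoint {A′} {R k} τₖ (proj₂ (proj₂ (R-conjugate k)))) p)

          y∈acl-A′X : y ∈ acl (A′ ∪ X.U k)
          y∈acl-A′X = act-acl {A′ ∪ X.U k} (τₖ ⁻¹)
            (acl-mono {X.U k ∪ R k} {τₖ ⁻¹ ⋆ (A′ ∪ X.U k)} XR⊆ {x} p)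

          y∈acl-B̂X : y ∈ acl (B̂ ∪ X.U k)
          y∈acl-B̂X = acl-mono {D} {B̂ ∪ X.U k} (λ p → inj₁ (DX⊆B̂ k (inj₁ p))) {y}
            (proj₂ (Fixes⇒⋆-acl {D} (τₖ ⁻¹) fixD) q)

          y∈acl-X : y ∈ acl (X.U k)
          y∈acl-X = proj₁ (A′⊥ᴹB̂ (X.U k) (X.X₀⊆U k)
            (λ p → ⊆acl {B̂ ∪ C} (inj₁ (DX⊆B̂ k (inj₂ p))))) {y} (y∈acl-A′X , y∈acl-B̂X)

          τy∈ : act τₖ y ∈ acl (X.U k)
          τy∈ = proj₂ (Fixes⇒⋆-acl {X.U k} τₖ fixX) {y} y∈acl-X

        -- Finitely many generators of x lie in C or in some `X.U j ∪ R j` with `j < k`; in the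
        -- second case `acl-next` removes `R j`.
        acl-X∩acl-D : ∀ k {x} → x ∈ acl (X.U k) → x ∈ acl D → x ∈ acl C
        acl-X∩acl-D = <-rec (λ k → ∀ {x} → x ∈ acl (X.U k) → x ∈ acl D → x ∈ acl C)
          λ k rec {x} p q →
            let xs , xs⊆X , generate = acl-finite {X.U k} {x} p in
            split k {x} rec q xs generate (X.finite xs xs⊆X)
          where
          split : ∀ k {x} → (∀ j → j < k → ∀ {x} → x ∈ acl (X.U j) → x ∈ acl D → x ∈ acl C) →
            x ∈ acl D → ∀ xs → (∀ {Y : Subset} → All Y xs → x ∈ acl Y) →
            All C xs ⊎ (∃[ j ] j < k × All (X.U j ∪ R j) xs) → x ∈ acl C
          split k rec q xs generate (inj₁ xs⊆C) = generate {C} xs⊆C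
          split k {x} rec q xs generate (inj₂ (j , j<k , xs⊆)) =
            rec j j<k {x} (acl-next j {x} (generate {X.U j ∪ R j} xs⊆) q) q

        acl-D∩acl-X≐acl-C : ∀ k → acl C ≐ (acl D ∩ acl (X.U k))
        acl-D∩acl-X≐acl-C k =
          (λ {x} p → acl-mono {C} {D} (λ q → BC⊆D (inj₂ q)) {x} p ,
                     acl-mono {C} {X.U k} (X.X₀⊆U k) {x} p) ,
          (λ {x} (p , q) → acl-X∩acl-D k {x} q p)

        D⊥R : ∃[ k ] D ⊥[ X.U k ] R k
        D⊥R =
          let Z , Z⊆X∞ , (inj , _) , ind = proj₂ (local-character sD) sX∞
              k , Z⊆X = X.cofinal Z Z⊆X∞ (Injection.to inj) (Injection.injective inj)
          in k , mono sD sX∞ (sX k) id (X.A⊆U∞ k)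
                   (base-mono sD sX∞ (sX k) Z⊆X (X.U⊆U∞ k) ind)

        A′⊥aclC-at : ∀ k → D ⊥[ X.U k ] R k → A′ ⊥[ acl C ] B
        A′⊥aclC-at k D⊥Rₖ = mono sA′ sDX (small-acl sC) id (λ p → inj₁ (BC⊆D (inj₁ p)))
          (respects sA′ sDX (small-⊆ proj₁ (small-acl sD)) ≐-refl ≐-refl (acl-D∩acl-X≐acl-C k)
            (intersection sA′ sDX sD (sX k) inj₁ inj₂ over-D over-X))
          where
          sDX : IsSmall (D ∪ X.U k)
          sDX = small-∪ sD (sX k)

          over-D : A′ ⊥[ D ] (D ∪ X.U k)
          over-D = mono sA′ sB̂ sD id (DX⊆B̂ k) A′⊥B̂

          over-X : A′ ⊥[ X.U k ] (D ∪ X.U k)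
          -- `D⊥Rₖ` is turned round and carried along `τ k`, which takes A′ to `R k` and fixes the
          -- base and the right side.
          over-X = transport (τ k) (sR k) sDX (sX k) (proj₂ (proj₂ (R-conjugate k)))
            (≐-sym (Fixes⇒⋆ {D ∪ X.U k} (τ k) (τ-fixes k)))
            (≐-sym (Fixes⇒⋆ {X.U k} (τ k)
              (Fixes-⊆ {X.U k} {D ∪ X.U k} (τ k) inj₂ (τ-fixes k))))
            (symmetry sDX (sR k) (sX k) (normality sD (sR k) (sX k) D⊥Rₖ))

        A′⊥aclC : A′ ⊥[ acl C ] B
        A′⊥aclC = A′⊥aclC-at (proj₁ D⊥R) (proj₂ D⊥R)

      A′⊥stage : ∃[ i ] A′ ⊥[ Outer.U i ] B̂
      A′⊥stage =
        -- The outer length was fixed by the cardinal of A before A′ existed, so local character is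
        -- used for A against a conjugate of B̂ and carried over by ρ.
        let Z , Z⊆ , (inj , _) , ind = proj₂ (local-character sA) (small-⋆ (ρ ⁻¹) sB̂)
            i , Z⊆U = Outer.cofinal (ρ ⋆ Z)
              (λ p → proj₁ (⁻¹⋆⋆ {B̂} (ρ ⁻¹)) (Z⊆ p))
              (λ (x , p) → Injection.to inj (act ρ x , p))
              (λ eq → act-injective ρ (Injection.injective inj eq))
            sZ = small-⊆ Z⊆ (small-⋆ (ρ ⁻¹) sB̂)
        in i , base-mono sA′ sB̂ (small-⊆ (Outer.U⊆U∞ i) sB̂) Z⊆U (Outer.U⊆U∞ i)
                 (transport ρ sA (small-⋆ (ρ ⁻¹) sB̂) sZ A′≐ (≐-sym (⁻¹⋆⋆ {B̂} (ρ ⁻¹))) ≐-refl ind)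

      A′⊥aclC : ∀ i → A′ ⊥[ Outer.U i ] B̂ → A′ ⊥[ acl C ] B
      A′⊥aclC i A′⊥ = OverStage.A′⊥aclC (proj₁ layer⊇) (λ p → proj₂ D≐U (Outer.X₀⊆U i p))
        (λ p → Outer.A⊆U∞ i (proj₂ layer⊇ p))
        (respects sA′ sB̂ (small-⊆ (Outer.U⊆U∞ i) sB̂) ≐-refl ≐-refl D≐U A′⊥)
        where
        D : Subset
        -- The layer stores the closure of this decoded set, not of the coextensive `Outer.U i`.
        D = decode (char (Outer.stage i))

        D≐U : D ≐ Outer.U i
        D≐U = ≐-trans (decode-char {S = Outer.stage i}) (Outer.stage≐U i)

        layer⊇ : Σ[ sD ∈ IsSmall D ] closure sD ⊆ Outer.layer i
        layer⊇ = whenSmall-elim {F = closure} (λ X → Σ[ sD ∈ IsSmall D ] closure sD ⊆ X)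
          (small-⊆ (λ p → Outer.U⊆U∞ i (proj₁ D≐U p)) sB̂) (λ sD → sD , id)

      -- Intersection stops at `acl C`. Transitivity leads down to C, since existence over C extends
      -- to give independence of A′ from `acl C`.
      A′⊥B : A′ ⊥[ acl C ] B → A′ ⊥[ C ] B
      A′⊥B A′⊥aclC = symmetry sB sA′ sC (mono (small-∪ sB saclC) sA′ sC inj₁ id
        (transitive sA′ sB saclC (⊆acl {C})
          (symmetry sA′ sB saclC A′⊥aclC)
          (symmetry sA′ saclC sC (mono sA′ (small-acl (small-∪ sC sC)) sC id
            (λ {x} → acl-mono {C} {C ∪ C} inj₁ {x})
            (extend-acl sA′ sC sC (existence sA′ sC))))))
        where
        saclC : IsSmall (acl C)
        saclC = small-acl sC

      A⊥B : A ⊥[ C ] B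
      A⊥B = transport (ρ ⁻¹) sA′ sB sC
        (≐-sym (⋆-adjoint {A′} {A} ρ A′≐))
        (≐-sym (Fixes⇒⋆ {B} (ρ ⁻¹) (Fixes-⊆ {B} {B ∪ C} (ρ ⁻¹) inj₁ fix⁻¹)))
        (≐-sym (Fixes⇒⋆ {C} (ρ ⁻¹) (Fixes-⊆ {C} {B ∪ C} (ρ ⁻¹) inj₂ fix⁻¹)))
        (A′⊥B (A′⊥aclC (proj₁ A′⊥stage) (proj₂ A′⊥stage)))
        where
        fix⁻¹ : Fixes (ρ ⁻¹) (B ∪ C)
        fix⁻¹ = Fixes-⁻¹ {B ∪ C} ρ ρ-fixes

    ⊥þ⇒⊥ : A ⊥þ[ C ] B → A ⊥[ C ] B
    ⊥þ⇒⊥ A⊥þB =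
      let A′ , A′≡A , ind = A⊥þB B̂ (unsmall sB̂) (λ p → inj₁ (inj₁ p))
      in A⊥B (proj₁ A′≡A) (proj₁ (proj₂ A′≡A)) (≡[]⇒⋆ {A′} {B ∪ C} {A} A′≡A) ind

theorem3p3 : (∀ {a} → ExcludedMiddle a) → (∀ {a b} → Extensionality a b) →
    ∀ (L : Signature) (T : Syntax.Theory L) → Consistent T → Complete T →
    (𝔐 : Structure L (suc 0ℓ)) → Semantics.IsModelOf 𝔐 T →
    let open BigModel 𝔐 in
    Saturated → StronglyHomogeneous →
    ∀ {ℓ} (_⊥[_]_ : TernaryRelation ℓ) → IsCanonical _⊥[_]_ →
    ∀ {A B C} → Small A → Small B → Small C →
    (A ⊥[ C ] B) ⇔ (A ⊥þ[ C ] B)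
theorem3p3 em ext L T _ _ 𝔐 _ _ homogeneous _⊥[_]_ canonical sA sB sC = mk⇔
  (⊥⇒⊥þ (λ sB → anti-reflexivity (unsmall sB)) (small sA) (small sB) (small sC))
  (Converse.⊥þ⇒⊥ homogeneous
    (λ sA sB sC₁ sC₂ → intersection (unsmall sA) (unsmall sB) (unsmall sC₁) (unsmall sC₂))
    (small sA) (small sB) (small sC))
  where
  open BigModel 𝔐
  open IsCanonical canonical
  open IsStrict isStrict
  open Smallness em ext 𝔐
  open Independence em ext 𝔐 _⊥[_]_ isIndependenceRelation
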